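{- Let $\alpha=(\alpha_1,\dots,\alpha_s)\in\mathbb{Z}^s$ with $\alpha_i\cdot\alpha_{i+1}<0$ for all $1\le i\le s-1$, $\alpha_1\ge 0$, and $s$ even if $s\ne 1$. Let $T$ be a tournament of order $n=\sum_{i=1}^s|\alpha_i|$. Then $$g_T(\alpha)=g_T(-\alpha),$$ where $-\alpha=(-\alpha_1,\dots,-\alpha_s)$ and $g_T(\gamma)$ denotes the number of oriented (here necessarily Hamiltonian) cycles of $T$ of type $C(\gamma)$.
   Context: A tournament is an orientation of a finite complete graph. An oriented cycle $C=v_1v_2\dots v_m$ ($m\ge 3$) in a tournament $T$ consists of distinct vertices $v_1,\dots,v_m$ together with the arcs of $T$ joining consecutive vertices and the arc joining $v_m$ and $v_1$; cycles are identified with their arc sets. A block is a maximal directed subpath (a directed cycle, also called a circuit, is regarded as having a single block). Let $\alpha=(\alpha_1,\dots,\alpha_s)$ be a tuple of nonzero integers with alternating signs, with $s=1$ or $s$ even. The cycle $C$ is of type $C(\alpha)$ if it has $\sum|\alpha_i|$ vertices and, for some starting vertex and some sense of traversal, one meets successively exactly $s$ blocks $I_1,\dots,I_s$ (the traversal starting at the beginning of $I_1$), with $I_i$ of length $|\alpha_i|$ and directed in the sense of the traversal iff $\alpha_i>0$. For $s=1$, both types $C(m)$ and $C(-m)$ are the directed cycles of length $m$. $g_T(\alpha)$ is the number of cycles in $T$ of type $C(\alpha)$, each cycle counted once. -}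

module Defs where

open import Level using (0ℓ)
open import Data.Bool using (Bool)
import Data.Bool.Properties as Bool
open import Data.Fin using (Fin)
import Data.Fin.Properties as Fin
open import Data.Integer using (ℤ; ∣_∣; _◃_)
import Data.Integer.Properties as ℤ
open import Data.List using (List; []; _∷_; allFin; cartesianProductWith; deduplicate; filter; head; last; length; map)
import Data.List.Properties as List
import Data.Maybe.Properties as Maybe
open import Data.Nat using (ℕ; zero; suc; _≤_)
import Data.Nat.Properties as ℕ
open import Data.Product using (_×_; _,_; uncurry)
import Data.Product.Properties as Product
open import Data.Sign using (Sign)
import Data.Sign.Properties as Sign
open import Data.Sum using (_⊎_)
open import Data.Vec as Vec using (Vec; []; _∷_; _∷ʳ_; tabulate; toList)
import Data.Vec.Membership.DecPropositional as DecMembership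
import Data.Vec.Properties as Vec
import Data.Vec.Relation.Unary.AllPairs as AllPairs
open import Data.Vec.Relation.Unary.Unique.Propositional using (Unique)
open import Relation.Binary using (Rel; Decidable; DecidableEquality; Trichotomous)
open import Relation.Binary.Consequences using (tri⇒dec<)
open import Relation.Binary.PropositionalEquality using (_≡_; _≢_)
open import Relation.Nullary using (Dec; yes; no; does; ¬?; _×-dec_; _⊎-dec_)
import Relation.Unary as Unary

-- Trichotomy: there are no loops, and any two distinct vertices are joined by
-- an arc in exactly one of the two directions.
record Tournament (n : ℕ) : Set₁ where
  field
    Arc     : Rel (Fin n) 0ℓ
    compare : Trichotomous _≡_ Arc

  arc? : Decidable Arc
  arc? = tri⇒dec< compare

open Tournament public

size : ∀ {s} → Vec ℤ s → ℕ
size α = Vec.sum (Vec.map ∣_∣ α)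

-- The pairs (v₁ , v₂), (v₂ , v₃), …, (vₘ , v₁).
rotate : ∀ {A : Set} {m} → Vec A m → Vec A m
rotate []       = []
rotate (x ∷ xs) = xs ∷ʳ x

steps : ∀ {A : Set} {m} → Vec A m → Vec (A × A) m
steps v = Vec.zip v (rotate v)

module _ {n : ℕ} (T : Tournament n) where

  -- + when the arc joining u and w goes from u to w, - when it goes from w to u.
  direction : Fin n → Fin n → Sign
  direction u w with arc? T u w
  ... | yes _ = Sign.+
  ... | no  _ = Sign.-

  directions : ∀ {m} → Vec (Fin n) m → List Sign
  directions v = toList (Vec.map (uncurry direction) (steps v))

  orient : Fin n → Fin n → Fin n × Fin n
  orient u w with arc? T u w
  ... | yes _ = u , w
  ... | no  _ = w , u

-- The maximal constant runs of a word, each with its sign and its length.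
extend : Sign → List (Sign × ℕ) → List (Sign × ℕ)
extend d []             = (d , 1) ∷ []
extend d ((e , k) ∷ bs) with d Sign.≟ e
... | yes _ = (e , suc k) ∷ bs
... | no  _ = (d , 1) ∷ (e , k) ∷ bs

runs : List Sign → List (Sign × ℕ)
runs []       = []
runs (d ∷ ds) = extend d (runs ds)

signedRuns : List Sign → List ℤ
signedRuns ds = map (uncurry _◃_) (runs ds)

-- The traversal v₁ v₂ … vₘ v₁ meets successively blocks with signed lengths α.
-- The last conjunct says that v₁ is the beginning of a block, so that no block
-- of the cycle is cut in two at v₁; a directed cycle is a single block, started
-- anywhere.
Traversal : ∀ {n s m} → Tournament n → Vec ℤ s → Vec (Fin n) m → Set
Traversal {s = s} {m} T α v =
  3 ≤ m × Unique v × signedRuns ds ≡ toList α × (s ≡ 1 ⊎ head ds ≢ last ds)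
  where ds = directions T v

traversal? : ∀ {n s m} (T : Tournament n) (α : Vec ℤ s) →
             Unary.Decidable (Traversal {m = m} T α)
traversal? {s = s} {m} T α v =
  (3 ℕ.≤? m)
    ×-dec AllPairs.allPairs? (λ x y → ¬? (x Fin.≟ y)) v
    ×-dec List.≡-dec ℤ._≟_ (signedRuns ds) (toList α)
    ×-dec ((s ℕ.≟ 1) ⊎-dec ¬? (Maybe.≡-dec Sign._≟_ (head ds) (last ds)))
  where ds = directions T v

-- Sets of arcs, as Boolean matrices, so that _≡_ is equality of sets.
ArcSet : ℕ → Set
ArcSet n = Vec (Vec Bool n) n

_≟ᴬ_ : ∀ {n} → DecidableEquality (ArcSet n)
_≟ᴬ_ = Vec.≡-dec (Vec.≡-dec Bool._≟_)

arcSet : ∀ {n m} → Tournament n → Vec (Fin n) m → ArcSet n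
arcSet {n} T v = tabulate λ x → tabulate λ y → does ((x , y) ∈? arcs)
  where
  open DecMembership (Product.≡-dec (Fin._≟_ {n}) Fin._≟_) using (_∈?_)
  arcs = Vec.map (uncurry (orient T)) (steps v)

sequences : ∀ n m → List (Vec (Fin n) m)
sequences n zero    = [] ∷ []
sequences n (suc m) = cartesianProductWith _∷_ (allFin n) (sequences n m)

-- A cycle is of type C(α) when some traversal of it, in either sense, realises
-- α. Cycles are their arc sets: those with several such traversals occur once.
cyclesOfType : ∀ {n s} → Tournament n → Vec ℤ s → List (ArcSet n)
cyclesOfType {n} T α =
  deduplicate _≟ᴬ_ (map (arcSet T) (filter (traversal? T α) (sequences n (size α))))

g : ∀ {n s} → Tournament n → Vec ℤ s → ℕ
g T α = length (cyclesOfType T α)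

{-# OPTIONS --safe #-}
-- Count the vertex sequences whose cyclic word of directions is a given w.
-- By inclusion–exclusion over the letters − of w it suffices to count the
-- sequences for patterns over {+, free}. Cut at its free steps, such a pattern
-- is a family of directed paths whose order does not matter, so reversing the
-- pattern, while each path keeps its sense, leaves the count unchanged; hence
-- N(w) = N(reverse w) = N(−w), the last by traversing the cycles backwards.
-- It remains that each cycle is counted equally often. If u has word w and u′
-- has word −w, the bijection τ taking each uᵢ to u′ᵢ reverses every arc of the
-- cycle u. It therefore carries the traversals with word w of that cycle to
-- the traversals with word −w of the cycle u′.
module Submission where

open import Defs
open import Data.Bool using (true)
open import Data.Empty using (⊥-elim)
open import Data.Fin using (Fin; inject₁) renaming (suc to fsuc)
import Data.Fin.Properties as Fin
open import Data.Integer using (ℤ; 0ℤ; ∣_∣; _◃_; sign; -_)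
import Data.Integer as ℤ
import Data.Integer.Properties as ℤ
open import Data.List using (List; []; _∷_; _++_; _∷ʳ_; concatMap; deduplicate; drop; filter; head; last; length; map; replicate; reverse; take)
open import Data.List.Membership.Propositional using (_∈_)
open import Data.List.Membership.Propositional.Properties
open import Data.List.Properties
open import Data.List.Relation.Binary.Permutation.Propositional using (_↭_; ↭-refl; ↭-sym; ↭-trans; ↭-prep; ↭-reflexive; ↭⇒↭ₛ)
open import Data.List.Relation.Binary.Permutation.Propositional.Properties using (∷↭∷ʳ; ++-comm; ++⁺ʳ; ↭-reverse; ↭-length)
import Data.List.Relation.Binary.Permutation.Setoid.Properties as Permutation
open import Data.List.Relation.Binary.Pointwise as Pointwise using (Pointwise; []; _∷_; decidable)
open import Data.List.Relation.Unary.All as All using (All; []; _∷_)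
import Data.List.Relation.Unary.All.Properties as All
open import Data.List.Relation.Unary.Any using (here; there)
open import Data.List.Relation.Unary.Unique.DecPropositional.Properties using (deduplicate-!)
open import Data.List.Relation.Unary.Unique.Propositional using (Unique; []; _∷_)
import Data.List.Relation.Unary.Unique.Propositional.Properties as Unique
open import Data.Maybe using (Maybe; just; nothing)
import Data.Maybe.Properties as Maybe
open import Data.Nat using (ℕ; zero; suc; _+_; _*_; _≤_; z≤n; s≤s; >-nonZero)
open import Data.Nat.Divisibility using (_∣_)
import Data.Nat.Properties as ℕ
open import Data.Product as Product using (_×_; _,_; proj₁; proj₂; ∃; ∃₂; swap; uncurry)
import Data.Product.Properties as Product
open import Data.Sign using (Sign; opposite)
import Data.Sign.Properties as Sign
open import Data.Sum as Sum using (_⊎_; inj₁; inj₂; [_,_]′)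
open import Data.Vec as Vec using (Vec; []; _∷_; toList; lookup; tabulate)
import Data.Vec.Membership.DecPropositional as DecMembership
import Data.Vec.Membership.Propositional as Vec
import Data.Vec.Membership.Propositional.Properties as Vec
import Data.Vec.Properties as Vec
import Data.Vec.Relation.Unary.All as VecAll
import Data.Vec.Relation.Unary.All.Properties as VecAll
import Data.Vec.Relation.Unary.AllPairs as VecAllPairs
import Data.Vec.Relation.Unary.Unique.Propositional as VecUnique
import Data.Vec.Relation.Unary.Unique.Propositional.Properties as VecUnique
open import Function using (_∘_; id; mk⇔)
open import Relation.Binary using (DecidableEquality; tri<; tri≈; tri>)
open import Relation.Binary.PropositionalEquality
open import Relation.Nullary using (Dec; yes; no; does; ¬_; ¬?; contradiction)
open import Relation.Nullary.Decidable using (does-⇔; dec-true; map′)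
open import Relation.Unary using (Decidable)

-- Counting in lists, closed walks, and exchange of segments.

-- Induction that deletes one occurrence of `f x` from `ys`: injectivity keeps the images of the
-- other elements away from the deleted entry. The inequalities between counts below all rest on
-- this.
length-≤-injection : ∀ {A B : Set} {xs : List A} {ys : List B} (f : A → B) → Unique xs →
  (∀ {x} → x ∈ xs → f x ∈ ys) →
  (∀ {x x′} → x ∈ xs → x′ ∈ xs → f x ≡ f x′ → x ≡ x′) →
  length xs ≤ length ys
length-≤-injection {xs = []} f _ _ _ = z≤n
length-≤-injection {xs = x ∷ xs} f (x∉xs ∷ xs!) f∈ inj with ∈-∃++ (f∈ (here refl))
... | as , bs , refl = begin
  suc (length xs)             ≤⟨ s≤s (length-≤-injection f xs! f∈′ λ p q → inj (there p) (there q)) ⟩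
  suc (length (as ++ bs))     ≡⟨ cong suc (length-++ as) ⟩
  suc (length as + length bs) ≡⟨ ℕ.+-suc (length as) (length bs) ⟨
  length as + suc (length bs) ≡⟨ length-++ as ⟨
  length (as ++ f x ∷ bs)     ∎
  where
  open ℕ.≤-Reasoning
  f∈′ : ∀ {x′} → x′ ∈ xs → f x′ ∈ as ++ bs
  f∈′ p with ∈-++⁻ as (f∈ (there p))
  ... | inj₁ q = ∈-++⁺ˡ q
  ... | inj₂ (there q) = ∈-++⁺ʳ as q
  ... | inj₂ (here eq) = contradiction (inj (here refl) (there p) (sym eq)) (All.lookup x∉xs p)

rotateˡ : ∀ {A : Set} → List A → List A
rotateˡ []      = []
rotateˡ (x ∷ v) = v ∷ʳ x

module _ {A : Set} where

  count : {P : A → Set} → Decidable P → List A → ℕ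
  count P? xs = length (filter P? xs)

  count-≡ : {P Q : A → Set} (P? : Decidable P) (Q? : Decidable Q) →
    (∀ {x} → P x → Q x) → (∀ {x} → Q x → P x) → ∀ xs → count P? xs ≡ count Q? xs
  count-≡ P? Q? to from xs = cong length (filter-≐ P? Q? (to , from) xs)

  count-⊎ : {P Q R : A → Set} (P? : Decidable P) (Q? : Decidable Q) (R? : Decidable R) →
    (∀ {x} → P x → Q x ⊎ R x) → (∀ {x} → Q x → P x) → (∀ {x} → R x → P x) →
    (∀ {x} → Q x → ¬ R x) → ∀ xs → count P? xs ≡ count Q? xs + count R? xs
  count-⊎ P? Q? R? split Q⇒P R⇒P Q∩R = go
    where
    go : ∀ xs → count P? xs ≡ count Q? xs + count R? xs
    go [] = refl
    go (x ∷ xs) with P? x | Q? x | R? x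
    ... | _     | yes q | yes r = contradiction r (Q∩R q)
    ... | yes _ | yes _ | no _  = cong suc (go xs)
    ... | yes _ | no _  | yes _ = trans (cong suc (go xs)) (sym (ℕ.+-suc _ _))
    ... | yes p | no ¬q | no ¬r = ⊥-elim ([ ¬q , ¬r ]′ (split p))
    ... | no ¬p | yes q | no _  = contradiction (Q⇒P q) ¬p
    ... | no ¬p | no _  | yes r = contradiction (R⇒P r) ¬p
    ... | no _  | no _  | no _  = go xs

  -- The end point is kept apart from the list so that an induction can move the start while the
  -- closing vertex stays fixed. The closed form `circuit` is the list counterpart of `steps`.
  walk : A → List A → A → List (A × A)
  walk x []      y = (x , y) ∷ []
  walk x (w ∷ v) y = (x , w) ∷ walk w v y

  circuit : List A → List (A × A)
  circuit []      = []
  circuit (x ∷ v) = walk x v x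

  walk-∷ʳ : ∀ x v w y → walk x (v ∷ʳ w) y ≡ walk x v w ∷ʳ (w , y)
  walk-∷ʳ x []      w y = refl
  walk-∷ʳ x (u ∷ v) w y = cong ((x , u) ∷_) (walk-∷ʳ u v w y)

  walk-reverse : ∀ x v y → walk x (reverse v) y ≡ reverse (map swap (walk y v x))
  walk-reverse x []      y = refl
  walk-reverse x (w ∷ v) y = begin
    walk x (reverse (w ∷ v)) y                    ≡⟨ cong (λ u → walk x u y) (unfold-reverse w v) ⟩
    walk x (reverse v ∷ʳ w) y                     ≡⟨ walk-∷ʳ x (reverse v) w y ⟩
    walk x (reverse v) w ∷ʳ (w , y)               ≡⟨ cong (_∷ʳ (w , y)) (walk-reverse x v w) ⟩
    reverse (map swap (walk w v x)) ∷ʳ (w , y)    ≡⟨ unfold-reverse (w , y) (map swap (walk w v x)) ⟨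
    reverse (map swap (walk y (w ∷ v) x))         ∎
    where open ≡-Reasoning

  walk-distinct : ∀ x v y → Unique (x ∷ v) → All (_≢ y) (x ∷ v) → All (uncurry _≢_) (walk x v y)
  walk-distinct x []      y _ (x≢y ∷ []) = x≢y ∷ []
  walk-distinct x (w ∷ v) y ((x≢w ∷ _) ∷ v!) (_ ∷ v≢y) = x≢w ∷ walk-distinct w v y v! v≢y

  -- The circuit of a single vertex is a loop, hence the bound on the length.
  circuit-distinct : ∀ v → Unique v → 2 ≤ length v → All (uncurry _≢_) (circuit v)
  circuit-distinct (x ∷ [])    _ (s≤s ())
  circuit-distinct (x ∷ w ∷ v) ((x≢w ∷ x∉v) ∷ v!) _ =
    x≢w ∷ walk-distinct w v x v! (All.map ≢-sym (x≢w ∷ x∉v))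

  circuit-rotateˡ : ∀ x v → circuit (v ∷ʳ x) ≡ rotateˡ (circuit (x ∷ v))
  circuit-rotateˡ x []      = refl
  circuit-rotateˡ x (w ∷ v) = walk-∷ʳ w v x w

  -- Backward traversal from the same starting vertex. Keeping `x` in front makes the list of steps
  -- reverse exactly, with no rotation left to correct.
  flipCircuit : List A → List A
  flipCircuit []      = []
  flipCircuit (x ∷ v) = x ∷ reverse v

  circuit-flip : ∀ v → circuit (flipCircuit v) ≡ reverse (map swap (circuit v))
  circuit-flip []      = refl
  circuit-flip (x ∷ v) = walk-reverse x v x

  flipCircuit-↭ : ∀ v → flipCircuit v ↭ v
  flipCircuit-↭ []      = ↭-refl
  flipCircuit-↭ (x ∷ v) = ↭-prep x (↭-reverse v)

  flipCircuit-involutive : ∀ v → flipCircuit (flipCircuit v) ≡ v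
  flipCircuit-involutive []      = refl
  flipCircuit-involutive (x ∷ v) = cong (x ∷_) (reverse-involutive v)

  -- Swaps the first `k` entries with the next `l`. The segments are given by their lengths so that
  -- this is a function of the sequence alone, undone by `exchange l k`.
  exchange : ℕ → ℕ → List A → List A
  exchange k l v = take l (drop k v) ++ take k v ++ drop l (drop k v)

  take-length-++ : ∀ (xs ys : List A) → take (length xs) (xs ++ ys) ≡ xs
  take-length-++ []       ys = refl
  take-length-++ (x ∷ xs) ys = cong (x ∷_) (take-length-++ xs ys)

  drop-length-++ : ∀ (xs ys : List A) → drop (length xs) (xs ++ ys) ≡ ys
  drop-length-++ []       ys = refl
  drop-length-++ (x ∷ xs) ys = drop-length-++ xs ys

  exchange-++ : ∀ a b c → exchange (length a) (length b) (a ++ b ++ c) ≡ b ++ a ++ c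
  exchange-++ a b c
    rewrite drop-length-++ a (b ++ c) | take-length-++ a (b ++ c)
          | drop-length-++ b c | take-length-++ b c = refl

  exchange-↭ : ∀ (a b c : List A) → b ++ a ++ c ↭ a ++ b ++ c
  exchange-↭ a b c = ↭-trans (↭-reflexive (sym (++-assoc b a c)))
    (↭-trans (++⁺ʳ c (++-comm b a)) (↭-reflexive (++-assoc a b c)))

reverse-replicate : ∀ {A : Set} k (x : A) → reverse (replicate k x) ≡ replicate k x
reverse-replicate zero x = refl
reverse-replicate (suc k) x = begin
  reverse (x ∷ replicate k x)  ≡⟨ unfold-reverse x (replicate k x) ⟩
  reverse (replicate k x) ∷ʳ x ≡⟨ cong (_∷ʳ x) (reverse-replicate k x) ⟩
  replicate k x ∷ʳ x           ≡⟨ replicate-∷ʳ k ⟩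
  replicate (suc k) x          ∎
  where
  open ≡-Reasoning
  replicate-∷ʳ : ∀ k → replicate k x ∷ʳ x ≡ x ∷ replicate k x
  replicate-∷ʳ zero    = refl
  replicate-∷ʳ (suc k) = cong (x ∷_) (replicate-∷ʳ k)

reverse-middle : ∀ {A : Set} (xs : List A) x ys → reverse (xs ++ x ∷ ys) ≡ reverse ys ++ x ∷ reverse xs
reverse-middle xs x ys = begin
  reverse (xs ++ x ∷ ys)           ≡⟨ reverse-++ xs (x ∷ ys) ⟩
  reverse (x ∷ ys) ++ reverse xs   ≡⟨ cong (_++ reverse xs) (unfold-reverse x ys) ⟩
  (reverse ys ∷ʳ x) ++ reverse xs  ≡⟨ ∷ʳ-++ (reverse ys) x (reverse xs) ⟩
  reverse ys ++ x ∷ reverse xs     ∎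
  where open ≡-Reasoning

-- Patterns with fixed and free letters.

-- A constraint on the direction of a step; nothing leaves it free.
Pattern : Set
Pattern = List (Maybe Sign)

pattern ⊕ = just Sign.+
pattern ⊖ = just Sign.-
pattern ⊛ = nothing

data Meets : Maybe Sign → Sign → Set where
  free  : ∀ {s} → Meets ⊛ s
  fixed : ∀ {s} → Meets (just s) s

meets? : ∀ c s → Dec (Meets c s)
meets? ⊛ s = yes free
meets? (just t) s = map′ (λ { refl → fixed }) (λ { fixed → refl }) (t Sign.≟ s)

pattern-word⁺ : ∀ {w ss} → w ≡ ss → Pointwise Meets (map just w) ss
pattern-word⁺ {[]}    refl = []
pattern-word⁺ {x ∷ w} refl = fixed ∷ pattern-word⁺ refl

pattern-word⁻ : ∀ {w ss} → Pointwise Meets (map just w) ss → w ≡ ss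
pattern-word⁻ {[]}    []           = refl
pattern-word⁻ {x ∷ w} (fixed ∷ ms) = cong (x ∷_) (pattern-word⁻ ms)

split-± : ∀ p {q ss} → Pointwise Meets (p ++ ⊛ ∷ q) ss →
  Pointwise Meets (p ++ ⊕ ∷ q) ss ⊎ Pointwise Meets (p ++ ⊖ ∷ q) ss
split-± []      (_∷_ {y = Sign.+} _ ms) = inj₁ (fixed ∷ ms)
split-± []      (_∷_ {y = Sign.-} _ ms) = inj₂ (fixed ∷ ms)
split-± (c ∷ p) (m ∷ ms) with split-± p ms
... | inj₁ ms′ = inj₁ (m ∷ ms′)
... | inj₂ ms′ = inj₂ (m ∷ ms′)

weaken : ∀ p {c q ss} → Pointwise Meets (p ++ c ∷ q) ss → Pointwise Meets (p ++ ⊛ ∷ q) ss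
weaken []      (_ ∷ ms) = free ∷ ms
weaken (_ ∷ p) (m ∷ ms) = m ∷ weaken p ms

exclusive-± : ∀ p {q ss} → Pointwise Meets (p ++ ⊕ ∷ q) ss → ¬ Pointwise Meets (p ++ ⊖ ∷ q) ss
exclusive-± []      (fixed ∷ _) (() ∷ _)
exclusive-± (_ ∷ p) (_ ∷ ms) (_ ∷ ms′) = exclusive-± p ms ms′

-- Counting vertex sequences by their cyclic word.

-- E enumerates a class of vertex sequences; δ gives the directions of the steps.
module Counting {V : Set} (δ : V → V → Sign) (E : List (List V)) (E! : Unique E)
  (E-↭ : ∀ {v v′} → v′ ↭ v → v ∈ E → v′ ∈ E) where

  word : List V → List Sign
  word v = map (uncurry δ) (circuit v)

  Cyclic : Pattern → List V → Set
  Cyclic p v = Pointwise Meets p (word v)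

  cyclic? : ∀ p → Decidable (Cyclic p)
  cyclic? p v = decidable meets? p (word v)

  -- The last constraint concerns no step of the path and has to be free.
  data Linear : Pattern → List V → Set where
    []   : Linear [] []
    skip : ∀ {p u v} → Linear p v → Linear (⊛ ∷ p) (u ∷ v)
    step : ∀ {p u w v s} → δ u w ≡ s → Linear p (w ∷ v) → Linear (just s ∷ p) (u ∷ w ∷ v)

  linear? : ∀ p → Decidable (Linear p)
  linear? []           []          = yes []
  linear? []           (u ∷ v)     = no λ ()
  linear? (⊛ ∷ p)      []          = no λ ()
  linear? (⊛ ∷ p)      (u ∷ v)     = map′ skip (λ { (skip l) → l }) (linear? p v)
  linear? (just s ∷ p) []          = no λ ()
  linear? (just s ∷ p) (u ∷ [])    = no λ ()
  linear? (just s ∷ p) (u ∷ w ∷ v) with δ u w Sign.≟ s | linear? p (w ∷ v)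
  ... | yes e | yes l = yes (step e l)
  ... | no ¬e | _     = no λ { (step e _) → ¬e e }
  ... | _     | no ¬l = no λ { (step _ l) → ¬l l }

  N L : Pattern → ℕ
  N p = count (cyclic? p) E
  L p = count (linear? p) E

  -- Since `E` is closed under permutation, a map that only rearranges each sequence stays inside
  -- `E`, and a left inverse makes it injective. Exchange, rotation and backward traversal are all
  -- used in this form.
  count-≤ : {P Q : List V → Set} (P? : Decidable P) (Q? : Decidable Q) (f f⁻¹ : List V → List V) →
    (∀ {v} → v ∈ E → P v → Q (f v) × f v ↭ v × f⁻¹ (f v) ≡ v) → count P? E ≤ count Q? E
  count-≤ {P} {Q} P? Q? f f⁻¹ H = length-≤-injection f (Unique.filter⁺ P? E!)
    (λ x∈ → let v∈E , Pv = ∈-filter⁻ P? x∈; Qfv , fv↭v , _ = H v∈E Pv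
            in ∈-filter⁺ Q? (E-↭ fv↭v v∈E) Qfv)
    (λ x∈ y∈ eq → trans (sym (inverse x∈)) (trans (cong f⁻¹ eq) (inverse y∈)))
    where
    inverse : ∀ {v} → v ∈ filter P? E → f⁻¹ (f v) ≡ v
    inverse v∈ = let v∈E , Pv = ∈-filter⁻ P? v∈ in proj₂ (proj₂ (H v∈E Pv))

  Linear-length : ∀ {p v} → Linear p v → length v ≡ length p
  Linear-length []         = refl
  Linear-length (skip l)   = cong suc (Linear-length l)
  Linear-length (step _ l) = cong suc (Linear-length l)

  Linear-++⁺ : ∀ {p q v w} → Linear p v → Linear q w → Linear (p ++ q) (v ++ w)
  Linear-++⁺ []         m = m
  Linear-++⁺ (skip l)   m = skip (Linear-++⁺ l m)
  Linear-++⁺ (step e l) m = step e (Linear-++⁺ l m)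

  -- A free constraint ties no two vertices together, so the sequence can be cut there. The free
  -- constraint stays behind as the end of the left piece.
  Linear-++⁻ : ∀ p {q v} → Linear (p ++ ⊛ ∷ q) v →
    ∃₂ λ a b → v ≡ a ++ b × Linear (p ∷ʳ ⊛) a × Linear q b
  Linear-++⁻ [] (skip {u = u} l) = u ∷ [] , _ , refl , skip [] , l
  Linear-++⁻ (⊛ ∷ p) (skip {u = u} l) with Linear-++⁻ p l
  ... | a , b , refl , la , lb = u ∷ a , b , refl , skip la , lb
  Linear-++⁻ (just s ∷ p) (step {u = u} e l) with Linear-++⁻ p l
  ... | w ∷ a , b , refl , la , lb = u ∷ w ∷ a , b , refl , step e la , lb
  -- The left piece has the length of `p ∷ʳ ⊛`, so it is not empty and does supply the vertex `w`
  -- after `u`.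
  ... | [] , b , eq , la , lb with () ← trans (Linear-length la) (length-++-sucʳ p ⊛ [])

  -- The last constraint falls on the closing step back to the first vertex. If it is free, the
  -- condition concerns only the path that remains.
  Cyclic⇒Linear : ∀ p {v} → Cyclic (p ∷ʳ ⊛) v → Linear (p ∷ʳ ⊛) v
  Cyclic⇒Linear []      {[]} ()
  Cyclic⇒Linear (_ ∷ p) {[]} ()
  Cyclic⇒Linear p {x ∷ v} = go p x v
    where
    go : ∀ p u v {y} → Pointwise Meets (p ∷ʳ ⊛) (map (uncurry δ) (walk u v y)) → Linear (p ∷ʳ ⊛) (u ∷ v)
    go []                u []          _           = skip []
    go []                u (w ∷ [])    (_ ∷ ())
    go []                u (w ∷ _ ∷ _) (_ ∷ ())
    go (_ ∷ [])          u []          (_ ∷ ())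
    go (_ ∷ _ ∷ p)       u []          (_ ∷ ())
    go (⊛ ∷ p)           u (w ∷ v)     (_ ∷ ms)     = skip (go p w v ms)
    go (just s ∷ p)      u (w ∷ v)     (fixed ∷ ms) = step refl (go p w v ms)

  -- A nonempty `Linear` pattern ends in a free constraint, which the closing step meets whatever
  -- its direction.
  Linear⇒Cyclic : ∀ {p v} → Linear p v → Cyclic p v
  Linear⇒Cyclic {v = []} [] = []
  Linear⇒Cyclic {v = x ∷ v} l = go l
    where
    go : ∀ {p u v y} → Linear p (u ∷ v) → Pointwise Meets p (map (uncurry δ) (walk u v y))
    go {v = []}    (skip [])     = free ∷ []
    go {v = _ ∷ _} (skip l)      = free ∷ go l
    go             (step refl l) = fixed ∷ go l

  N≡L : ∀ p → N (p ∷ʳ ⊛) ≡ L (p ∷ʳ ⊛)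
  N≡L p = count-≡ (cyclic? _) (linear? _) (Cyclic⇒Linear p) Linear⇒Cyclic E

  -- No constraint links the stretches of vertices governed by `p ∷ʳ ⊛`, by `q ∷ʳ ⊛` and by `r`, so
  -- the first two can trade places, each unchanged inside.
  L-exchange : ∀ p q r → L (p ++ ⊛ ∷ q ++ ⊛ ∷ r) ≡ L (q ++ ⊛ ∷ p ++ ⊛ ∷ r)
  L-exchange p q r = ℕ.≤-antisym (L-exchange-≤ p q r) (L-exchange-≤ q p r)
    where
    L-exchange-≤ : ∀ p q r → L (p ++ ⊛ ∷ q ++ ⊛ ∷ r) ≤ L (q ++ ⊛ ∷ p ++ ⊛ ∷ r)
    L-exchange-≤ p q r = count-≤ (linear? _) (linear? _) (exchange k l) (exchange l k) λ _ → exchanged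
      where
      k = length (p ∷ʳ ⊛)
      l = length (q ∷ʳ ⊛)
      exchanged : ∀ {v} → Linear (p ++ ⊛ ∷ q ++ ⊛ ∷ r) v →
        Linear (q ++ ⊛ ∷ p ++ ⊛ ∷ r) (exchange k l v) × exchange k l v ↭ v × exchange l k (exchange k l v) ≡ v
      exchanged lin with Linear-++⁻ p lin
      ... | a , _ , refl , la , lin′ with Linear-++⁻ q lin′
      ... | b , c , refl , lb , lc
        -- The pieces `a` and `b` have exactly the lengths `k` and `l`, so `exchange` cuts at the
        -- right places.
        rewrite sym (Linear-length la) | sym (Linear-length lb) | exchange-++ a b c | exchange-++ b a c
        = subst₂ Linear (trans (∷ʳ-++ q ⊛ _) (cong (λ t → q ++ ⊛ ∷ t) (∷ʳ-++ p ⊛ r))) refl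
            (Linear-++⁺ lb (Linear-++⁺ la lc))
        , exchange-↭ a b c , refl

  Positive : Pattern → Set
  Positive = All (_≢ ⊖)

  -- Positivity makes each piece between free constraints a run of `⊕`, equal to its own reversal,
  -- so only the order of the pieces has to be reversed. In the induction `k` counts the leading
  -- letters `⊕` already read, and `r` takes up the pieces already moved.
  L-reverse : ∀ p r → Positive p → L (p ++ ⊛ ∷ r) ≡ L (reverse p ++ ⊛ ∷ r)
  L-reverse p r = go 0 p r
    where
    open ≡-Reasoning
    -- The directed paths between free steps are permuted, each keeping its sense.
    go : ∀ k p r → Positive p →
      L ((replicate k ⊕ ++ p) ++ ⊛ ∷ r) ≡ L (reverse (replicate k ⊕ ++ p) ++ ⊛ ∷ r)
    go k [] r _ rewrite ++-identityʳ (replicate k ⊕) | reverse-replicate k ⊕ = refl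
    go k (⊖ ∷ p) r (⊖≢ ∷ _) = contradiction refl ⊖≢
    go k (⊕ ∷ p) r (_ ∷ pos) = subst (λ t → L (t ++ ⊛ ∷ r) ≡ L (reverse t ++ ⊛ ∷ r)) (shift k) (go (suc k) p r pos)
      where
      shift : ∀ k → replicate (suc k) ⊕ ++ p ≡ replicate k ⊕ ++ ⊕ ∷ p
      shift zero    = refl
      shift (suc k) = cong (⊕ ∷_) (shift k)
    -- The leading run `s` moves behind `p` and joins the context. Once `p` is reversed, `s` stands
    -- exactly where the reversed pattern wants it.
    go k (⊛ ∷ p) r (_ ∷ pos) = begin
      L ((s ++ ⊛ ∷ p) ++ ⊛ ∷ r)          ≡⟨ cong L (++-assoc s (⊛ ∷ p) _) ⟩
      L (s ++ ⊛ ∷ p ++ ⊛ ∷ r)            ≡⟨ L-exchange s p r ⟩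
      L (p ++ ⊛ ∷ s ++ ⊛ ∷ r)            ≡⟨ go 0 p (s ++ ⊛ ∷ r) pos ⟩
      L (reverse p ++ ⊛ ∷ s ++ ⊛ ∷ r)    ≡⟨ cong L (++-assoc (reverse p) (⊛ ∷ s) _) ⟨
      L ((reverse p ++ ⊛ ∷ s) ++ ⊛ ∷ r)  ≡⟨ cong (λ t → L (t ++ ⊛ ∷ r)) reverse-s⊛p ⟨
      L (reverse (s ++ ⊛ ∷ p) ++ ⊛ ∷ r)  ∎
      where
      s = replicate k ⊕
      reverse-s⊛p : reverse (s ++ ⊛ ∷ p) ≡ reverse p ++ ⊛ ∷ s
      reverse-s⊛p = trans (reverse-middle s ⊛ p) (cong (λ t → reverse p ++ ⊛ ∷ t) (reverse-replicate k ⊕))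

  -- Starting the same closed walk one vertex later rotates its word. The inverse is rotation to the
  -- right, written as `rotateˡ` conjugated by `reverse`.
  N-rotateˡ : ∀ c p → N (c ∷ p) ≤ N (p ∷ʳ c)
  N-rotateˡ c p = count-≤ (cyclic? _) (cyclic? _) rotateˡ (reverse ∘ rotateˡ ∘ reverse) λ _ → rotated
    where
    rotated : ∀ {v} → Cyclic (c ∷ p) v →
      Cyclic (p ∷ʳ c) (rotateˡ v) × rotateˡ v ↭ v × reverse (rotateˡ (reverse (rotateˡ v))) ≡ v
    rotated {x ∷ v} ms =
      subst (Pointwise Meets (p ∷ʳ c)) (sym (word-rotateˡ x v)) (Pointwise-rotateˡ ms)
      , ↭-sym (∷↭∷ʳ x v)
      , (begin
        reverse (rotateˡ (reverse (v ∷ʳ x)))  ≡⟨ cong (reverse ∘ rotateˡ) (reverse-++ v (x ∷ [])) ⟩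
        reverse (reverse v ∷ʳ x)              ≡⟨ cong reverse (unfold-reverse x v) ⟨
        reverse (reverse (x ∷ v))             ≡⟨ reverse-involutive (x ∷ v) ⟩
        x ∷ v                                 ∎)
      where
      open ≡-Reasoning
      Pointwise-rotateˡ : ∀ {ss} → Pointwise Meets (c ∷ p) ss → Pointwise Meets (p ∷ʳ c) (rotateˡ ss)
      Pointwise-rotateˡ (m ∷ ms) = Pointwise.++⁺ ms (m ∷ [])
      map-rotateˡ : ∀ {A B : Set} (f : A → B) xs → map f (rotateˡ xs) ≡ rotateˡ (map f xs)
      map-rotateˡ f []       = refl
      map-rotateˡ f (x ∷ xs) = map-++ f xs (x ∷ [])
      word-rotateˡ : ∀ x v → word (v ∷ʳ x) ≡ rotateˡ (word (x ∷ v))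
      word-rotateˡ x v = trans (cong (map (uncurry δ)) (circuit-rotateˡ x v)) (map-rotateˡ _ (circuit (x ∷ v)))

  -- Moving the letters of `p` one by one to the end gives an inequality. The same argument with `p`
  -- and `q` interchanged gives its converse.
  N-++-comm : ∀ p q → N (p ++ q) ≡ N (q ++ p)
  N-++-comm p q = ℕ.≤-antisym (N-++-comm-≤ p q) (N-++-comm-≤ q p)
    where
    N-++-comm-≤ : ∀ p q → N (p ++ q) ≤ N (q ++ p)
    N-++-comm-≤ []      q = ℕ.≤-reflexive (cong N (sym (++-identityʳ q)))
    N-++-comm-≤ (c ∷ p) q = begin
      N (c ∷ p ++ q)      ≤⟨ N-rotateˡ c (p ++ q) ⟩
      N ((p ++ q) ∷ʳ c)   ≡⟨ cong N (++-assoc p q _) ⟩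
      N (p ++ (q ∷ʳ c))   ≤⟨ N-++-comm-≤ p (q ∷ʳ c) ⟩
      N ((q ∷ʳ c) ++ p)   ≡⟨ cong N (∷ʳ-++ q c p) ⟩
      N (q ++ c ∷ p)      ∎
      where open ℕ.≤-Reasoning

  -- Without a free constraint the pattern is constant and equals its reversal. Otherwise rotation
  -- brings a free constraint to the closing step, the cyclic count becomes a count of paths, and
  -- `L-reverse` applies. The remaining steps rotate back.
  N-reverse-positive : ∀ p → Positive p → N p ≡ N (reverse p)
  N-reverse-positive p pos with directed-or-free p pos
    where
    directed-or-free : ∀ p → Positive p → (∃ λ k → p ≡ replicate k ⊕) ⊎ (∃₂ λ a b → p ≡ a ++ ⊛ ∷ b)
    directed-or-free [] [] = inj₁ (0 , refl)
    directed-or-free (⊛ ∷ p) _ = inj₂ ([] , p , refl)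
    directed-or-free (⊖ ∷ p) (⊖≢ ∷ _) = contradiction refl ⊖≢
    directed-or-free (⊕ ∷ p) (_ ∷ pos) with directed-or-free p pos
    ... | inj₁ (k , refl)     = inj₁ (suc k , refl)
    ... | inj₂ (a , b , refl) = inj₂ (⊕ ∷ a , b , refl)
  ... | inj₁ (k , refl) = cong N (sym (reverse-replicate k ⊕))
  ... | inj₂ (a , b , refl) = begin
    N (a ++ ⊛ ∷ b)                  ≡⟨ N-++-comm a (⊛ ∷ b) ⟩
    N (⊛ ∷ b ++ a)                  ≡⟨ N-++-comm (⊛ ∷ []) (b ++ a) ⟩
    N ((b ++ a) ∷ʳ ⊛)               ≡⟨ N≡L (b ++ a) ⟩
    L ((b ++ a) ∷ʳ ⊛)               ≡⟨ L-reverse (b ++ a) [] (All.++⁺ (All.tail (All.++⁻ʳ a pos)) (All.++⁻ˡ a pos)) ⟩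
    L (reverse (b ++ a) ∷ʳ ⊛)       ≡⟨ N≡L (reverse (b ++ a)) ⟨
    N (reverse (b ++ a) ∷ʳ ⊛)       ≡⟨ cong (λ t → N (t ∷ʳ ⊛)) (reverse-++ b a) ⟩
    N ((reverse a ++ reverse b) ∷ʳ ⊛) ≡⟨ cong N (++-assoc (reverse a) (reverse b) _) ⟩
    N (reverse a ++ (reverse b ∷ʳ ⊛)) ≡⟨ N-++-comm (reverse a) _ ⟩
    N ((reverse b ∷ʳ ⊛) ++ reverse a) ≡⟨ cong (λ t → N (t ++ reverse a)) (unfold-reverse ⊛ b) ⟨
    N (reverse (⊛ ∷ b) ++ reverse a)  ≡⟨ cong N (reverse-++ a (⊛ ∷ b)) ⟨
    N (reverse (a ++ ⊛ ∷ b))          ∎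
    where open ≡-Reasoning

  N-± : ∀ p q → N (p ++ ⊛ ∷ q) ≡ N (p ++ ⊕ ∷ q) + N (p ++ ⊖ ∷ q)
  N-± p q = count-⊎ (cyclic? _) (cyclic? _) (cyclic? _) (split-± p) (weaken p) (weaken p) (exclusive-± p) E

  absorb : ∀ p c q → N ((p ∷ʳ c) ++ q) ≡ N (reverse ((p ∷ʳ c) ++ q)) →
    N (p ++ c ∷ q) ≡ N (reverse (p ++ c ∷ q))
  absorb p c q = subst (λ t → N t ≡ N (reverse t)) (∷ʳ-++ p c q)

  -- Induction on the part `q` still to be scanned, while `p` collects letters without `⊖`. At a `⊖`
  -- the count is the one for `⊛` less the one for `⊕`, and both of these continue with a shorter
  -- `q`.
  N-reverse-++ : ∀ p q → Positive p → N (p ++ q) ≡ N (reverse (p ++ q))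
  N-reverse-++ p [] pos rewrite ++-identityʳ p = N-reverse-positive p pos
  N-reverse-++ p (⊛ ∷ q) pos = absorb p ⊛ q (N-reverse-++ (p ∷ʳ ⊛) q (All.∷ʳ⁺ pos λ ()))
  N-reverse-++ p (⊕ ∷ q) pos = absorb p ⊕ q (N-reverse-++ (p ∷ʳ ⊕) q (All.∷ʳ⁺ pos λ ()))
  -- Subtraction is avoided by adding the count for `⊕` to both sides and cancelling it.
  N-reverse-++ p (⊖ ∷ q) pos = ℕ.+-cancelˡ-≡ (N (p ++ ⊕ ∷ q)) _ _ (begin
    N (p ++ ⊕ ∷ q) + N (p ++ ⊖ ∷ q)                      ≡⟨ N-± p q ⟨
    N (p ++ ⊛ ∷ q)                                       ≡⟨ absorb p ⊛ q (N-reverse-++ (p ∷ʳ ⊛) q (All.∷ʳ⁺ pos λ ())) ⟩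
    N (reverse (p ++ ⊛ ∷ q))                             ≡⟨ cong N (reverse-middle p ⊛ q) ⟩
    N (reverse q ++ ⊛ ∷ reverse p)                       ≡⟨ N-± (reverse q) (reverse p) ⟩
    N (reverse q ++ ⊕ ∷ reverse p) + N (reverse q ++ ⊖ ∷ reverse p)
      ≡⟨ cong₂ (λ s t → N s + N t) (reverse-middle p ⊕ q) (reverse-middle p ⊖ q) ⟨
    N (reverse (p ++ ⊕ ∷ q)) + N (reverse (p ++ ⊖ ∷ q))
      ≡⟨ cong (_+ N (reverse (p ++ ⊖ ∷ q))) (absorb p ⊕ q (N-reverse-++ (p ∷ʳ ⊕) q (All.∷ʳ⁺ pos λ ()))) ⟨
    N (p ++ ⊕ ∷ q) + N (reverse (p ++ ⊖ ∷ q))            ∎)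
    where open ≡-Reasoning

  _hasWord?_ : ∀ v w → Dec (word v ≡ w)
  v hasWord? w = ≡-dec Sign._≟_ (word v) w

  W : List Sign → ℕ
  W w = count (_hasWord? w) E

  W≡N : ∀ w → W w ≡ N (map just w)
  W≡N w = count-≡ (_hasWord? w) (cyclic? (map just w)) (pattern-word⁺ ∘ sym) (sym ∘ pattern-word⁻) E

  W-reverse : ∀ w → W w ≡ W (reverse w)
  W-reverse w = begin
    W w                        ≡⟨ W≡N w ⟩
    N (map just w)             ≡⟨ N-reverse-++ [] (map just w) [] ⟩
    N (reverse (map just w))   ≡⟨ cong N (reverse-map just w) ⟨
    N (map just (reverse w))   ≡⟨ W≡N (reverse w) ⟨
    W (reverse w)              ∎
    where open ≡-Reasoning

  module _ (δ-swap : ∀ {x y} → x ≢ y → δ y x ≡ opposite (δ x y))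
    (E⁻ : ∀ {v} → v ∈ E → Unique v × 2 ≤ length v) where

    -- Going backwards changes both the order of the steps and the sign of each. The change of sign
    -- needs the two ends of a step to differ.
    word-flip : ∀ {v} → v ∈ E → word (flipCircuit v) ≡ map opposite (reverse (word v))
    word-flip {v} v∈E = begin
      map (uncurry δ) (circuit (flipCircuit v))           ≡⟨ cong (map (uncurry δ)) (circuit-flip v) ⟩
      map (uncurry δ) (reverse (map swap (circuit v)))    ≡⟨ reverse-map (uncurry δ) (map swap (circuit v)) ⟩
      reverse (map (uncurry δ) (map swap (circuit v)))    ≡⟨ cong reverse (map-∘ (circuit v)) ⟨
      reverse (map (uncurry δ ∘ swap) (circuit v))        ≡⟨ cong reverse (map-cong-local (All.map δ-swap distinct)) ⟩
      reverse (map (opposite ∘ uncurry δ) (circuit v))    ≡⟨ cong reverse (map-∘ (circuit v)) ⟩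
      reverse (map opposite (word v))                     ≡⟨ reverse-map opposite (word v) ⟨
      map opposite (reverse (word v))                     ∎
      where
      open ≡-Reasoning
      distinct = circuit-distinct v (proj₁ (E⁻ v∈E)) (proj₂ (E⁻ v∈E))

    -- Backward traversal turns the word `reverse w` into `map opposite w`; `W-reverse` supplies the
    -- reversal that this leaves over.
    W-opposite-≤ : ∀ w → W w ≤ W (map opposite w)
    W-opposite-≤ w = begin
      W w                           ≡⟨ W-reverse w ⟩
      W (reverse w)                 ≤⟨ count-≤ (_hasWord? _) (_hasWord? _) flipCircuit flipCircuit flipped ⟩
      W (map opposite w)            ∎
      where
      open ℕ.≤-Reasoning
      flipped : ∀ {v} → v ∈ E → word v ≡ reverse w → word (flipCircuit v) ≡ map opposite w ×
        flipCircuit v ↭ v × flipCircuit (flipCircuit v) ≡ v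
      flipped {v} v∈E eq =
        trans (word-flip v∈E) (cong (map opposite) (trans (cong reverse eq) (reverse-involutive w)))
        , flipCircuit-↭ v , flipCircuit-involutive v

-- The size of an image when all fibres are equally large.

count-map : {A B : Set} {P : B → Set} (P? : Decidable P) (f : A → B) → ∀ xs →
  count P? (map f xs) ≡ count (P? ∘ f) xs
count-map P? f [] = refl
count-map P? f (x ∷ xs) with P? (f x)
... | yes _ = cong suc (count-map P? f xs)
... | no  _ = count-map P? f xs

length-count-∁ : {A : Set} {P : A → Set} (P? : Decidable P) → ∀ xs →
  length xs ≡ count P? xs + count (¬? ∘ P?) xs
length-count-∁ P? [] = refl
length-count-∁ P? (x ∷ xs) with P? x
... | yes _ = cong suc (length-count-∁ P? xs)
... | no  _ = trans (cong suc (length-count-∁ P? xs)) (sym (ℕ.+-suc _ _))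

module _ {A B : Set} (_≟_ : DecidableEquality B) (f : A → B) where

  fibre : List A → B → ℕ
  fibre xs y = count (λ x → f x ≟ y) xs

  -- Double counting by induction on `ys`: the fibre over `y` is split off, and its removal does not
  -- touch the fibres over the other values.
  length-fibres : ∀ {k} xs {ys} → Unique ys → (∀ {x} → x ∈ xs → f x ∈ ys) →
    (∀ {y} → y ∈ ys → fibre xs y ≡ k) → length xs ≡ length ys * k
  length-fibres []       {[]}     _ _  _ = refl
  length-fibres (x ∷ xs) {[]}     _ f∈ _ with () ← f∈ (here refl)
  length-fibres {k} xs {y ∷ ys} (y∉ys ∷ ys!) f∈ fibre≡k = begin
    length xs                         ≡⟨ length-count-∁ (λ x → f x ≟ y) xs ⟩
    fibre xs y + length rest          ≡⟨ cong₂ _+_ (fibre≡k (here refl)) (length-fibres rest ys! f∈ys fibre-rest) ⟩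
    k + length ys * k                 ∎
    where
    open ≡-Reasoning
    rest = filter (λ x → ¬? (f x ≟ y)) xs
    f∈ys : ∀ {x} → x ∈ rest → f x ∈ ys
    f∈ys x∈ with ∈-filter⁻ (λ x → ¬? (f x ≟ y)) x∈
    ... | x∈xs , fx≢y with f∈ x∈xs
    ... | here fx≡y   = contradiction fx≡y fx≢y
    ... | there fx∈ys = fx∈ys
    count-filter : ∀ {y′} → y′ ≢ y → ∀ zs → fibre (filter (λ x → ¬? (f x ≟ y)) zs) y′ ≡ fibre zs y′
    count-filter y′≢y [] = refl
    count-filter {y′} y′≢y (z ∷ zs) with f z ≟ y
    ... | no _ with f z ≟ y′
    ...   | yes _ = cong suc (count-filter y′≢y zs)
    ...   | no _  = count-filter y′≢y zs
    count-filter {y′} y′≢y (z ∷ zs) | yes fz≡y with f z ≟ y′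
    ...   | yes fz≡y′ = contradiction (trans (sym fz≡y′) fz≡y) y′≢y
    ...   | no _  = count-filter y′≢y zs
    fibre-rest : ∀ {y′} → y′ ∈ ys → fibre rest y′ ≡ k
    fibre-rest y′∈ys = trans (count-filter (All.lookup y∉ys y′∈ys ∘ sym) xs) (fibre≡k (there y′∈ys))

  length-deduplicate-map : ∀ {k} xs → (∀ {x} → x ∈ xs → fibre xs (f x) ≡ k) →
    length xs ≡ length (deduplicate _≟_ (map f xs)) * k
  length-deduplicate-map {k} xs fibre≡k = length-fibres xs (deduplicate-! _≟_ _) (∈-deduplicate⁺ _≟_ ∘ ∈-map⁺ f) fibre′
    where
    fibre′ : ∀ {y} → y ∈ deduplicate _≟_ (map f xs) → fibre xs y ≡ k
    fibre′ y∈ with ∈-map⁻ f (∈-deduplicate⁻ _≟_ (map f xs) y∈)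
    ... | x , x∈xs , refl = fibre≡k x∈xs

  -- Comparing every fibre with one fixed fibre of the other list shows that all fibres on both
  -- sides have one size `k`. Both lengths are then `k` times the number of images, and `k` cancels.
  equal-fibres⇒equal-images : ∀ xs ys → length xs ≡ length ys →
    (∀ {x y} → x ∈ xs → y ∈ ys → fibre xs (f x) ≡ fibre ys (f y)) →
    length (deduplicate _≟_ (map f xs)) ≡ length (deduplicate _≟_ (map f ys))
  equal-fibres⇒equal-images [] [] _ _ = refl
  equal-fibres⇒equal-images xs@(x ∷ _) ys@(y ∷ _) |xs|≡|ys| fibres = ℕ.*-cancelʳ-≡ _ _ k (begin
    length (deduplicate _≟_ (map f xs)) * k
      -- Two fibres within `xs` are compared by way of the fibre of `y`.
      ≡⟨ length-deduplicate-map xs (λ x∈ → trans (fibres x∈ (here refl)) (sym (fibres (here refl) (here refl)))) ⟨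
    length xs                               ≡⟨ |xs|≡|ys| ⟩
    length ys                               ≡⟨ length-deduplicate-map ys (λ y∈ → sym (fibres (here refl) y∈)) ⟩
    length (deduplicate _≟_ (map f ys)) * k ∎)
    where
    open ≡-Reasoning
    k = fibre xs (f x)
    -- The fibre of `x` contains `x`, which makes the cancellation of `k` legitimate.
    instance k≢0 = >-nonZero (∈-length (∈-filter⁺ (λ z → f z ≟ f x) {xs = xs} (here refl) refl))

-- Words and their signed runs.

-- A left inverse of `signedRuns`: it shows that the signed lengths of the blocks determine the
-- word.
expand : List ℤ → List Sign
expand = concatMap (λ i → replicate ∣ i ∣ (sign i))

expand-extend : ∀ d bs → expand (map (uncurry _◃_) (extend d bs)) ≡ d ∷ expand (map (uncurry _◃_) bs)
expand-extend Sign.+ [] = refl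
expand-extend Sign.- [] = refl
expand-extend d ((e , k) ∷ bs) with d Sign.≟ e
-- Blocks of length zero never come out of `runs`, but `bs` is arbitrary here.
expand-extend Sign.+ ((e , zero) ∷ bs)  | yes refl = refl
expand-extend Sign.- ((e , zero) ∷ bs)  | yes refl = refl
expand-extend Sign.+ ((e , suc k) ∷ bs) | yes refl = refl
expand-extend Sign.- ((e , suc k) ∷ bs) | yes refl = refl
expand-extend Sign.+ ((e , k) ∷ bs)     | no _ = refl
expand-extend Sign.- ((e , k) ∷ bs)     | no _ = refl

expand-signedRuns : ∀ ds → expand (signedRuns ds) ≡ ds
expand-signedRuns []       = refl
expand-signedRuns (d ∷ ds) = trans (expand-extend d (runs ds)) (cong (d ∷_) (expand-signedRuns ds))

signedRuns-injective : ∀ ds ds′ → signedRuns ds ≡ signedRuns ds′ → ds ≡ ds′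
signedRuns-injective ds ds′ eq =
  trans (sym (expand-signedRuns ds)) (trans (cong expand eq) (expand-signedRuns ds′))

extend-opposite : ∀ d bs → extend (opposite d) (map (Product.map₁ opposite) bs) ≡ map (Product.map₁ opposite) (extend d bs)
extend-opposite d [] = refl
extend-opposite d ((e , k) ∷ bs) with d Sign.≟ e | opposite d Sign.≟ opposite e
... | yes _    | yes _ = refl
... | no _     | no _  = refl
... | yes refl | no ≢  = contradiction refl ≢
... | no ≢     | yes p = contradiction (Sign.opposite-injective p) ≢

runs-opposite : ∀ ds → runs (map opposite ds) ≡ map (Product.map₁ opposite) (runs ds)
runs-opposite []       = refl
runs-opposite (d ∷ ds) = trans (cong (extend (opposite d)) (runs-opposite ds)) (extend-opposite d (runs ds))

opposite-◃ : ∀ s k → opposite s ◃ k ≡ - (s ◃ k)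
opposite-◃ Sign.+ zero    = refl
opposite-◃ Sign.- zero    = refl
opposite-◃ Sign.+ (suc k) = refl
opposite-◃ Sign.- (suc k) = refl

signedRuns-opposite : ∀ ds → signedRuns (map opposite ds) ≡ map -_ (signedRuns ds)
signedRuns-opposite ds = begin
  map (uncurry _◃_) (runs (map opposite ds))                        ≡⟨ cong (map (uncurry _◃_)) (runs-opposite ds) ⟩
  map (uncurry _◃_) (map (Product.map₁ opposite) (runs ds))         ≡⟨ map-∘ (runs ds) ⟨
  map (uncurry _◃_ ∘ Product.map₁ opposite) (runs ds)               ≡⟨ map-cong (λ (s , k) → opposite-◃ s k) (runs ds) ⟩
  map (-_ ∘ uncurry _◃_) (runs ds)                                  ≡⟨ map-∘ (runs ds) ⟩
  map -_ (signedRuns ds)                                            ∎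
  where open ≡-Reasoning

-- Passage between vectors and lists.

module _ {A : Set} where

  Unique-toList⁺ : ∀ {m} {v : Vec A m} → VecUnique.Unique v → Unique (toList v)
  Unique-toList⁺ VecUnique.[]         = []
  Unique-toList⁺ (x∉v VecUnique.∷ v!) = VecAll.toList⁺ x∉v ∷ Unique-toList⁺ v!

  Unique-toList⁻ : ∀ {m} {v : Vec A m} → Unique (toList v) → VecUnique.Unique v
  Unique-toList⁻ {v = []}    []         = VecUnique.[]
  Unique-toList⁻ {v = _ ∷ _} (x∉v ∷ v!) = VecAll.toList⁻ x∉v VecUnique.∷ Unique-toList⁻ v!

  toList-injective : ∀ {m} {v v′ : Vec A m} → toList v ≡ toList v′ → v ≡ v′
  toList-injective eq = trans (sym (Vec.cast-is-id refl _)) (Vec.toList-injective refl _ _ eq)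

  toList-zip-∷ʳ : ∀ {m} x (v : Vec A m) y → toList (Vec.zip (x ∷ v) (v Vec.∷ʳ y)) ≡ walk x (toList v) y
  toList-zip-∷ʳ x []      y = refl
  toList-zip-∷ʳ x (w ∷ v) y = cong ((x , w) ∷_) (toList-zip-∷ʳ w v y)

  toList-steps : ∀ {m} (v : Vec A m) → toList (steps v) ≡ circuit (toList v)
  toList-steps []      = refl
  toList-steps (x ∷ v) = toList-zip-∷ʳ x v x

walk-map : ∀ {A B : Set} (f : A → B) x v y → walk (f x) (map f v) (f y) ≡ map (Product.map f f) (walk x v y)
walk-map f x []      y = refl
walk-map f x (w ∷ v) y = cong ((f x , f w) ∷_) (walk-map f w v y)

circuit-map : ∀ {A B : Set} (f : A → B) v → circuit (map f v) ≡ map (Product.map f f) (circuit v)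
circuit-map f []      = refl
circuit-map f (x ∷ v) = walk-map f x v x

-- Hamiltonian vertex sequences.

sequences-! : ∀ n m → Unique (sequences n m)
sequences-! n zero    = [] ∷ []
sequences-! n (suc m) = Unique.cartesianProductWith⁺ _∷_ Vec.∷-injective (Unique.allFin⁺ n) (sequences-! n m)

∈-sequences : ∀ {n m} (v : Vec (Fin n) m) → v ∈ sequences n m
∈-sequences []      = here refl
∈-sequences (x ∷ v) = ∈-cartesianProductWith⁺ _∷_ (∈-allFin x) (∈-sequences v)

module _ {n : ℕ} where

  unique? : Decidable (VecUnique.Unique {A = Fin n} {n})
  unique? = VecAllPairs.allPairs? (λ x y → ¬? (x Fin.≟ y))

  -- All orderings of the vertex set, as lists: the class `E` to which the counting is applied.
  arrangements : List (List (Fin n))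
  arrangements = map toList (filter unique? (sequences n n))

  arrangements-! : Unique arrangements
  arrangements-! = Unique.map⁺ toList-injective (Unique.filter⁺ unique? (sequences-! n n))

  ∈-arrangements⁺ : ∀ {l : List (Fin n)} → Unique l → length l ≡ n → l ∈ arrangements
  ∈-arrangements⁺ {l} l! |l|≡n = subst (_∈ arrangements) toList-v
    (∈-map⁺ toList (∈-filter⁺ unique? (∈-sequences v) (Unique-toList⁻ (subst Unique (sym toList-v) l!))))
    where
    v = Vec.cast |l|≡n (Vec.fromList l)
    toList-v : toList v ≡ l
    toList-v = trans (Vec.toList-cast |l|≡n (Vec.fromList l)) (Vec.toList∘fromList l)

  ∈-arrangements⁻ : ∀ {l : List (Fin n)} → l ∈ arrangements → Unique l × length l ≡ n
  ∈-arrangements⁻ l∈ with ∈-map⁻ toList l∈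
  ... | v , v∈ , refl = Unique-toList⁺ (proj₂ (∈-filter⁻ unique? {xs = sequences n n} v∈)) , Vec.length-toList v

  arrangements-↭ : ∀ {l l′ : List (Fin n)} → l′ ↭ l → l ∈ arrangements → l′ ∈ arrangements
  arrangements-↭ l′↭l l∈ with ∈-arrangements⁻ l∈
  ... | l! , |l|≡n = ∈-arrangements⁺
    (Permutation.Unique-resp-↭ (setoid (Fin n)) (↭⇒↭ₛ (↭-sym l′↭l)) l!) (trans (↭-length l′↭l) |l|≡n)

  -- Pigeonhole: if `v` missed `a`, then `a ∷ v` would be `suc n` distinct elements of `Fin n`.
  lookup-surjective : {v : Vec (Fin n) n} → VecUnique.Unique v → ∀ a → ∃ λ i → lookup v i ≡ a
  lookup-surjective {v} v! a with Fin.any? (λ i → lookup v i Fin.≟ a)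
  ... | yes found = found
  ... | no ∄ = contradiction
    (Fin.injective⇒≤ {f = lookup (a ∷ v)} (VecUnique.lookup-injective (a∉v VecUnique.∷ v!) _ _)) ℕ.1+n≰n
    where
    a∉v : VecAll.All (a ≢_) v
    a∉v = VecAll.lookup⁻ λ i a≡ → ∄ (i , sym a≡)

-- Directions and arcs in a tournament, and maps that reverse them.

module _ {n : ℕ} (T : Tournament n) where

  direction-swap : ∀ {x y} → x ≢ y → direction T y x ≡ opposite (direction T x y)
  direction-swap {x} {y} x≢y with arc? T x y | arc? T y x
  ... | yes _ | no _ = refl
  ... | no _ | yes _ = refl
  ... | yes p | yes q with compare T x y
  ...   | tri< _ _ ¬q = contradiction q ¬q
  ...   | tri≈ _ p≡ _ = contradiction p≡ x≢y
  ...   | tri> ¬p _ _ = contradiction p ¬p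
  direction-swap {x} {y} x≢y | no ¬p | no ¬q with compare T x y
  ...   | tri< p _ _ = contradiction p ¬p
  ...   | tri≈ _ p≡ _ = contradiction p≡ x≢y
  ...   | tri> _ _ q = contradiction q ¬q

  orient-≡ : ∀ {x y x′ y′} → orient T x y ≡ orient T x′ y′ → (x , y) ≡ (x′ , y′) ⊎ (x , y) ≡ (y′ , x′)
  orient-≡ {x} {y} {x′} {y′} eq with arc? T x y | arc? T x′ y′ | eq
  ... | yes _ | yes _ | refl = inj₁ refl
  ... | yes _ | no _  | refl = inj₂ refl
  ... | no _  | yes _ | refl = inj₂ refl
  ... | no _  | no _  | refl = inj₁ refl

  orient-opposite : ∀ (τ : Fin n → Fin n) x y → direction T (τ x) (τ y) ≡ opposite (direction T x y) →
    orient T (τ x) (τ y) ≡ swap (Product.map τ τ (orient T x y))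
  orient-opposite τ x y eq with arc? T x y | arc? T (τ x) (τ y)
  ... | yes _ | no _  = refl
  ... | no _  | yes _ = refl
  orient-opposite τ x y () | yes _ | yes _
  orient-opposite τ x y () | no _ | no _

  open Counting (direction T) arrangements arrangements-! arrangements-↭

  arcs : List (Fin n) → List (Fin n × Fin n)
  arcs v = map (uncurry (orient T)) (circuit v)

  Opposite : (Fin n → Fin n) → Fin n × Fin n → Set
  Opposite τ (x , y) = direction T (τ x) (τ y) ≡ opposite (direction T x y)

  word-map : ∀ {τ} v → All (Opposite τ) (circuit v) → word (map τ v) ≡ map opposite (word v)
  word-map {τ} v op = begin
    map (uncurry (direction T)) (circuit (map τ v))                 ≡⟨ cong (map _) (circuit-map τ v) ⟩
    map (uncurry (direction T)) (map (Product.map τ τ) (circuit v)) ≡⟨ map-∘ (circuit v) ⟨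
    map (uncurry (direction T) ∘ Product.map τ τ) (circuit v)       ≡⟨ map-cong-local op ⟩
    map (opposite ∘ uncurry (direction T)) (circuit v)              ≡⟨ map-∘ (circuit v) ⟩
    map opposite (word v)                                           ∎
    where open ≡-Reasoning

  word-map⁻ : ∀ {τ} v → word (map τ v) ≡ map opposite (word v) → All (Opposite τ) (circuit v)
  word-map⁻ {τ} v eq = map≡⇒All (circuit v) (begin
    map (uncurry (direction T) ∘ Product.map τ τ) (circuit v)       ≡⟨ map-∘ (circuit v) ⟩
    map (uncurry (direction T)) (map (Product.map τ τ) (circuit v)) ≡⟨ cong (map _) (circuit-map τ v) ⟨
    word (map τ v)                                                  ≡⟨ eq ⟩
    map opposite (word v)                                           ≡⟨ map-∘ (circuit v) ⟨
    map (opposite ∘ uncurry (direction T)) (circuit v)              ∎)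
    where
    open ≡-Reasoning
    map≡⇒All : ∀ {A B : Set} {f g : A → B} xs → map f xs ≡ map g xs → All (λ x → f x ≡ g x) xs
    map≡⇒All []       _  = []
    map≡⇒All (x ∷ xs) eq = ∷-injectiveˡ eq ∷ map≡⇒All xs (∷-injectiveʳ eq)

  arcs-map : ∀ {τ} v → All (Opposite τ) (circuit v) → arcs (map τ v) ≡ map (swap ∘ Product.map τ τ) (arcs v)
  arcs-map {τ} v op = begin
    map (uncurry (orient T)) (circuit (map τ v))                    ≡⟨ cong (map _) (circuit-map τ v) ⟩
    map (uncurry (orient T)) (map (Product.map τ τ) (circuit v))    ≡⟨ map-∘ (circuit v) ⟨
    map (uncurry (orient T) ∘ Product.map τ τ) (circuit v)          ≡⟨ map-cong-local (All.map (λ {(x , y)} → orient-opposite τ x y) op) ⟩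
    map (swap ∘ Product.map τ τ ∘ uncurry (orient T)) (circuit v)   ≡⟨ map-∘ (circuit v) ⟩
    map (swap ∘ Product.map τ τ) (arcs v)                           ∎
    where open ≡-Reasoning

  -- Each step of `v` runs along an arc of `u`, in the same sense or the contrary one. In the
  -- contrary case both the step and its image change sign, so the relation between them persists.
  Opposite-transfer : ∀ {τ} u v → (∀ {a b} → τ a ≡ τ b → a ≡ b) → All (uncurry _≢_) (circuit u) →
    (∀ {a} → a ∈ arcs v → a ∈ arcs u) → All (Opposite τ) (circuit u) → All (Opposite τ) (circuit v)
  Opposite-transfer {τ} u v τ-injective distinct v⊆u op = All.tabulate transfer
    where
    open ≡-Reasoning
    transfer : ∀ {e} → e ∈ circuit v → Opposite τ e
    transfer {x , y} e∈ with ∈-map⁻ (uncurry (orient T)) (v⊆u (∈-map⁺ (uncurry (orient T)) e∈))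
    ... | (x′ , y′) , e′∈ , eq with orient-≡ eq
    ... | inj₁ refl = All.lookup op e′∈
    ... | inj₂ refl = begin
      -- Injectivity of `τ` keeps the images of the two ends distinct, as the change of sign
      -- requires.
      direction T (τ y′) (τ x′)                ≡⟨ direction-swap (x′≢y′ ∘ τ-injective) ⟩
      opposite (direction T (τ x′) (τ y′))     ≡⟨ cong opposite (All.lookup op e′∈) ⟩
      opposite (opposite (direction T x′ y′))  ≡⟨ cong opposite (direction-swap x′≢y′) ⟨
      opposite (direction T y′ x′)             ∎
      where x′≢y′ = All.lookup distinct e′∈

  directions-word : ∀ {m} (v : Vec (Fin n) m) → directions T v ≡ word (toList v)
  directions-word v = trans (Vec.toList-map _ (steps v)) (cong (map _) (toList-steps v))

  arcVec : ∀ {m} → Vec (Fin n) m → Vec (Fin n × Fin n) m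
  arcVec v = Vec.map (uncurry (orient T)) (steps v)

  toList-arcs : ∀ {m} (v : Vec (Fin n) m) → toList (arcVec v) ≡ arcs (toList v)
  toList-arcs v = trans (Vec.toList-map _ (steps v)) (cong (map _) (toList-steps v))

  open DecMembership (Product.≡-dec (Fin._≟_ {n}) (Fin._≟_ {n})) using (_∈?_)

  arcSet-cong : ∀ {m m′} (u : Vec (Fin n) m) (v : Vec (Fin n) m′) →
    (∀ {a} → a ∈ arcs (toList u) → a ∈ arcs (toList v)) →
    (∀ {a} → a ∈ arcs (toList v) → a ∈ arcs (toList u)) → arcSet T u ≡ arcSet T v
  arcSet-cong u v u⊆v v⊆u = Vec.tabulate-cong λ x → Vec.tabulate-cong λ y →
    does-⇔ (mk⇔ (via u v u⊆v) (via v u v⊆u)) ((x , y) ∈? arcVec u) ((x , y) ∈? arcVec v)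
    where
    via : ∀ {m m′} (u : Vec (Fin n) m) (v : Vec (Fin n) m′) → (∀ {a} → a ∈ arcs (toList u) → a ∈ arcs (toList v)) →
      ∀ {a} → a Vec.∈ arcVec u → a Vec.∈ arcVec v
    via u v u⊆v a∈ = Vec.∈-toList⁻ (subst (_ ∈_) (sym (toList-arcs v))
      (u⊆v (subst (_ ∈_) (toList-arcs u) (Vec.∈-toList⁺ a∈))))

  -- Membership of `(x , y)` is read off the corresponding entry of the matrix.
  arcSet⇒⊆ : ∀ {m m′} (u : Vec (Fin n) m) (v : Vec (Fin n) m′) → arcSet T u ≡ arcSet T v →
    ∀ {a} → a ∈ arcs (toList u) → a ∈ arcs (toList v)
  arcSet⇒⊆ u v eq {x , y} a∈ = subst (_ ∈_) (toList-arcs v) (Vec.∈-toList⁺ (does⇒ ((x , y) ∈? arcVec v) (begin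
    does ((x , y) ∈? arcVec v)         ≡⟨ entry v ⟨
    lookup (lookup (arcSet T v) x) y   ≡⟨ cong (λ M → lookup (lookup M x) y) eq ⟨
    lookup (lookup (arcSet T u) x) y   ≡⟨ entry u ⟩
    does ((x , y) ∈? arcVec u)
      ≡⟨ dec-true ((x , y) ∈? arcVec u) (Vec.∈-toList⁻ (subst (_ ∈_) (sym (toList-arcs u)) a∈)) ⟩
    true                               ∎)))
    where
    open ≡-Reasoning
    does⇒ : ∀ {P : Set} (p? : Dec P) → does p? ≡ true → P
    does⇒ (yes p) _ = p
    entry : ∀ {m} (v : Vec (Fin n) m) → lookup (lookup (arcSet T v) x) y ≡ does ((x , y) ∈? arcVec v)
    entry v = trans (cong (λ r → lookup r y) (Vec.lookup∘tabulate _ x)) (Vec.lookup∘tabulate _ y)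

  -- Traversals of two opposite types.

  -- The length is `n` instead of `size γ`, so that the traversals for a type and for its negative
  -- are vectors of one and the same type.
  traversals : ∀ {s} → Vec ℤ s → List (Vec (Fin n) n)
  traversals γ = filter (traversal? T γ) (sequences n n)

  ∈-traversals⁻ : ∀ {s} (γ : Vec ℤ s) {v} → v ∈ traversals γ → Traversal T γ v
  ∈-traversals⁻ γ v∈ = proj₂ (∈-filter⁻ (traversal? T γ) {xs = sequences n n} v∈)

  ∈-traversals⁺ : ∀ {s} (γ : Vec ℤ s) {v} → Traversal T γ v → v ∈ traversals γ
  ∈-traversals⁺ γ t = ∈-filter⁺ (traversal? T γ) (∈-sequences _) t

  module _ {s} (α β : Vec ℤ s) (β≡-α : toList β ≡ map -_ (toList α)) where

    same-word : ∀ {u v} → Traversal {m = n} T α u → Traversal {m = n} T α v → word (toList u) ≡ word (toList v)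
    same-word {u} {v} (_ , _ , eu , _) (_ , _ , ev , _) = begin
      word (toList u) ≡⟨ directions-word u ⟨
      directions T u  ≡⟨ signedRuns-injective (directions T u) (directions T v) (trans eu (sym ev)) ⟩
      directions T v  ≡⟨ directions-word v ⟩
      word (toList v) ∎
      where open ≡-Reasoning

    opposite-traversal : ∀ {u v} → Traversal {m = n} T α u → VecUnique.Unique v →
      word (toList v) ≡ map opposite (word (toList u)) → Traversal T β v
    opposite-traversal {u} {v} (3≤n , _ , eu , start) v! eq =
      3≤n , v! , trans (cong signedRuns ds≡) (trans (signedRuns-opposite (directions T u)) (trans (cong (map -_) eu) (sym β≡-α)))
      -- The first vertex still begins a block: if the first and last signs agree after negation,
      -- they agreed before it.
      , Sum.map₂ (λ h≢l h≡l → h≢l (Maybe.map-injective Sign.opposite-injective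
          (trans (sym (head-map (directions T u))) (trans (subst (λ ds → head ds ≡ last ds) ds≡ h≡l)
            (last-map opposite (directions T u)))))) start
      where
      ds≡ : directions T v ≡ map opposite (directions T u)
      ds≡ = trans (directions-word v) (trans eq (cong (map opposite) (sym (directions-word u))))

    opposite-word : ∀ {u v} → Traversal {m = n} T α u → Traversal {m = n} T β v →
      word (toList v) ≡ map opposite (word (toList u))
    opposite-word {u} {v} (_ , _ , eu , _) (_ , _ , ev , _) = begin
      word (toList v)                 ≡⟨ directions-word v ⟨
      directions T v
        ≡⟨ signedRuns-injective (directions T v) _ (trans ev (trans β≡-α (trans (cong (map -_) (sym eu)) (sym (signedRuns-opposite (directions T u)))))) ⟩
      map opposite (directions T u)   ≡⟨ cong (map opposite) (directions-word u) ⟩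
      map opposite (word (toList u))  ∎
      where open ≡-Reasoning

    -- All traversals of type `α` share one word `w`, so they are among the sequences counted by
    -- `W w`, and every sequence with the opposite word is a traversal of type `β`.
    traversals-≤ : length (traversals α) ≤ length (traversals β)
    traversals-≤ with traversals α in eq
    ... | [] = z≤n
    -- One traversal `u` is enough to fix `w`, and it also yields `3 ≤ n`, which rules out loops.
    ... | u ∷ us = begin
      length (u ∷ us)              ≡⟨ cong length eq ⟨
      length (traversals α)        ≤⟨ length-≤-injection id (Unique.filter⁺ (traversal? T α) (sequences-! n n)) α⇒w (λ _ _ → id) ⟩
      count (hasWord w) uniques    ≡⟨ count-map (_hasWord? w) toList uniques ⟨
      W w                          ≤⟨ W-opposite-≤ direction-swap long w ⟩
      W (map opposite w)           ≡⟨ count-map (_hasWord? _) toList uniques ⟩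
      count (hasWord (map opposite w)) uniques
        ≤⟨ length-≤-injection id (Unique.filter⁺ (hasWord _) (Unique.filter⁺ unique? (sequences-! n n))) w⇒β (λ _ _ → id) ⟩
      length (traversals β)        ∎
      where
      open ℕ.≤-Reasoning
      u∈ : Traversal T α u
      u∈ = ∈-traversals⁻ α (subst (u ∈_) (sym eq) (here refl))
      w = word (toList u)
      uniques = filter unique? (sequences n n)
      hasWord : ∀ w → Decidable (λ (v : Vec (Fin n) n) → word (toList v) ≡ w)
      hasWord w v = toList v hasWord? w
      long : ∀ {v} → v ∈ arrangements → Unique v × 2 ≤ length v
      long v∈ with ∈-arrangements⁻ v∈
      ... | v! , |v|≡n = v! , ℕ.≤-trans (ℕ.n≤1+n 2) (subst (3 ≤_) (sym |v|≡n) (proj₁ u∈))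
      α⇒w : ∀ {v} → v ∈ traversals α → v ∈ filter (hasWord w) uniques
      α⇒w v∈ = let t = ∈-traversals⁻ α v∈ in
        ∈-filter⁺ (hasWord w) (∈-filter⁺ unique? (∈-sequences _) (proj₁ (proj₂ t))) (same-word t u∈)
      w⇒β : ∀ {v} → v ∈ filter (hasWord (map opposite w)) uniques → v ∈ traversals β
      w⇒β v∈ = let v∈uniques , e = ∈-filter⁻ (hasWord _) {xs = uniques} v∈ in
        ∈-traversals⁺ β (opposite-traversal u∈ (proj₂ (∈-filter⁻ unique? {xs = sequences n n} v∈uniques)) e)

    -- A single `τ`, built from `u` and `u′`, serves the whole fibre: it reverses the steps of every
    -- `v` with the arcs of `u`, by `Opposite-transfer`, and its injectivity yields the inequality.
    fibre-≤ : ∀ {u u′} → u ∈ traversals α → u′ ∈ traversals β →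
      fibre _≟ᴬ_ (arcSet T) (traversals α) (arcSet T u) ≤ fibre _≟ᴬ_ (arcSet T) (traversals β) (arcSet T u′)
    fibre-≤ {u} {u′} u∈ u′∈ = length-≤-injection (Vec.map τ)
      (Unique.filter⁺ (λ v → arcSet T v ≟ᴬ arcSet T u) (Unique.filter⁺ (traversal? T α) (sequences-! n n)))
      transported (λ _ _ → Vec-map-injective)
      where
      tu = ∈-traversals⁻ α u∈
      tu′ = ∈-traversals⁻ β u′∈
      u! = proj₁ (proj₂ tu)
      u′! = proj₁ (proj₂ tu′)
      -- The sequence `u` passes through all `n` vertices, so every vertex has a position in it and
      -- `τ` is defined everywhere.
      position : Fin n → Fin n
      position a = proj₁ (lookup-surjective u! a)
      τ : Fin n → Fin n
      τ a = lookup u′ (position a)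
      τ-injective : ∀ {a b} → τ a ≡ τ b → a ≡ b
      τ-injective {a} {b} eq = trans (sym (proj₂ (lookup-surjective u! a)))
        (trans (cong (lookup u) (VecUnique.lookup-injective u′! _ _ eq)) (proj₂ (lookup-surjective u! b)))
      Vec-map-injective : ∀ {m} {v v′ : Vec (Fin n) m} → Vec.map τ v ≡ Vec.map τ v′ → v ≡ v′
      Vec-map-injective {v = []} {[]} _ = refl
      Vec-map-injective {v = _ ∷ _} {_ ∷ _} eq =
        cong₂ _∷_ (τ-injective (Vec.∷-injectiveˡ eq)) (Vec-map-injective (Vec.∷-injectiveʳ eq))
      τu≡u′ : Vec.map τ u ≡ u′
      τu≡u′ = begin
        Vec.map τ u                     ≡⟨ Vec.tabulate∘lookup _ ⟨
        tabulate (lookup (Vec.map τ u)) ≡⟨ Vec.tabulate-cong (λ i → trans (Vec.lookup-map i τ u)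
          (cong (lookup u′) (VecUnique.lookup-injective u! _ _ (proj₂ (lookup-surjective u! (lookup u i)))))) ⟩
        tabulate (lookup u′)            ≡⟨ Vec.tabulate∘lookup u′ ⟩
        u′                              ∎
        where open ≡-Reasoning
      distinct : All (uncurry _≢_) (circuit (toList u))
      distinct = circuit-distinct (toList u) (Unique-toList⁺ u!)
        (ℕ.≤-trans (ℕ.n≤1+n 2) (subst (3 ≤_) (sym (Vec.length-toList u)) (proj₁ tu)))
      opposite-u : All (Opposite τ) (circuit (toList u))
      -- The words of `u` and of its image `u′` are opposite letter by letter, so `τ` reverses each
      -- step of `u`.
      opposite-u = word-map⁻ (toList u) (trans (cong word (trans (sym (Vec.toList-map τ u)) (cong toList τu≡u′))) (opposite-word tu tu′))
      transported : ∀ {v} → v ∈ filter (λ v → arcSet T v ≟ᴬ arcSet T u) (traversals α) →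
        Vec.map τ v ∈ filter (λ v → arcSet T v ≟ᴬ arcSet T u′) (traversals β)
      transported {v} v∈ with ∈-filter⁻ (λ v → arcSet T v ≟ᴬ arcSet T u) {xs = traversals α} v∈
      ... | v∈α , v~u = ∈-filter⁺ (λ v → arcSet T v ≟ᴬ arcSet T u′)
        (∈-traversals⁺ β (opposite-traversal tv (VecUnique.map⁺ τ-injective (proj₁ (proj₂ tv)))
          (trans (cong word (Vec.toList-map τ v)) (word-map (toList v) opposite-v))))
        -- The arcs of the image of `v` are compared with those of the image of `u`, which is `u′`.
        (trans (arcSet-cong (Vec.map τ v) (Vec.map τ u) 
          (along v u opposite-v opposite-u v⊆u) (along u v opposite-u opposite-v u⊆v))
          (cong (arcSet T) τu≡u′))
        where
        tv = ∈-traversals⁻ α v∈α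
        v⊆u : ∀ {a} → a ∈ arcs (toList v) → a ∈ arcs (toList u)
        v⊆u = arcSet⇒⊆ v u v~u
        u⊆v : ∀ {a} → a ∈ arcs (toList u) → a ∈ arcs (toList v)
        u⊆v = arcSet⇒⊆ u v (sym v~u)
        opposite-v : All (Opposite τ) (circuit (toList v))
        opposite-v = Opposite-transfer (toList u) (toList v) τ-injective distinct v⊆u opposite-u
        -- On both cycles `τ` acts on arcs by the same map, `swap ∘ Product.map τ τ`, so an
        -- inclusion of arcs carries over to the images.
        along : ∀ (v u : Vec (Fin n) n) → All (Opposite τ) (circuit (toList v)) →
          All (Opposite τ) (circuit (toList u)) →
          (∀ {a} → a ∈ arcs (toList v) → a ∈ arcs (toList u)) →
          ∀ {a} → a ∈ arcs (toList (Vec.map τ v)) → a ∈ arcs (toList (Vec.map τ u))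
        along v u ov ou v⊆u a∈ rewrite Vec.toList-map τ v | Vec.toList-map τ u
          | arcs-map (toList v) ov | arcs-map (toList u) ou
          with ∈-map⁻ _ a∈
        ... | _ , b∈ , refl = ∈-map⁺ _ (v⊆u b∈)

  -- Both inequalities are used a second time with `α` and `β` interchanged. For this `β` is a
  -- variable tied to `α` by an equation, which turns around because negation is an involution.
  images-opposite : ∀ {s} (α β : Vec ℤ s) → toList β ≡ map -_ (toList α) →
    length (deduplicate _≟ᴬ_ (map (arcSet T) (traversals α))) ≡
    length (deduplicate _≟ᴬ_ (map (arcSet T) (traversals β)))
  images-opposite α β β≡-α = equal-fibres⇒equal-images _≟ᴬ_ (arcSet T) (traversals α) (traversals β)
    (ℕ.≤-antisym (traversals-≤ α β β≡-α) (traversals-≤ β α α≡-β))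
    (λ u∈ v∈ → ℕ.≤-antisym (fibre-≤ α β β≡-α u∈ v∈) (fibre-≤ β α α≡-β v∈ u∈))
    where
    open ≡-Reasoning
    α≡-β : toList α ≡ map -_ (toList β)
    α≡-β = begin
      toList α                       ≡⟨ map-id (toList α) ⟨
      map id (toList α)              ≡⟨ map-cong ℤ.neg-involutive (toList α) ⟨
      map (-_ ∘ -_) (toList α)       ≡⟨ map-∘ (toList α) ⟩
      map -_ (map -_ (toList α))     ≡⟨ cong (map -_) β≡-α ⟨
      map -_ (toList β)              ∎

  g-traversals : ∀ {s} (γ : Vec ℤ s) → n ≡ size γ →
    g T γ ≡ length (deduplicate _≟ᴬ_ (map (arcSet T) (traversals γ)))
  g-traversals γ refl = refl

size-neg : ∀ {s} (α : Vec ℤ s) → size (Vec.map -_ α) ≡ size α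
size-neg α = cong Vec.sum (trans (sym (Vec.map-∘ ℤ.∣_∣ -_ α)) (Vec.map-cong ℤ.∣-i∣≡∣i∣ α))

theorem19 : ∀ {n k : ℕ} (α : Vec ℤ (suc k)) (T : Tournament n) →
    (∀ (i : Fin k) → lookup α (inject₁ i) ℤ.* lookup α (fsuc i) ℤ.< 0ℤ) →
    0ℤ ℤ.≤ Vec.head α →
    (suc k ≢ 1 → 2 ∣ suc k) →
    n ≡ size α →
    g T α ≡ g T (Vec.map -_ α)
theorem19 α T _ _ _ n≡ = begin
  g T α                                                                     ≡⟨ g-traversals T α n≡ ⟩
  length (deduplicate _≟ᴬ_ (map (arcSet T) (traversals T α)))
    ≡⟨ images-opposite T α (Vec.map -_ α) (Vec.toList-map -_ α) ⟩
  length (deduplicate _≟ᴬ_ (map (arcSet T) (traversals T (Vec.map -_ α))))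
    ≡⟨ g-traversals T (Vec.map -_ α) (trans n≡ (sym (size-neg α))) ⟨
  g T (Vec.map -_ α)                                                        ∎
  where open ≡-Reasoning
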